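{- The logic $\mathbf{S4D}$ is the D-logic of the class of all topological spaces; that is, for every bimodal formula $A$, one has $A\in\mathbf{S4D}$ if and only if $A$ is valid in every topological space.
   Context: Formulas are built by $\phi ::= p \mid \bot \mid \phi\to\phi \mid \Box\phi \mid [\neq]\phi$, with $p$ ranging over propositional letters; the other Boolean connectives are the usual abbreviations, $\Diamond A=\neg\Box\neg A$, $\langle\neq\rangle A=\neg[\neq]\neg A$, and $[\forall]A=[\neq]A\wedge A$. A (bimodal) logic is a set of formulas containing all classical tautologies, $\Box(p\to q)\to(\Box p\to\Box q)$ and $[\neq](p\to q)\to([\neq]p\to[\neq]q)$, and closed under Substitution, Modus Ponens, and the two Generalization rules $A/\Box A$ and $A/[\neq]A$. $\mathbf{K_2}$ is the minimal logic, and $L+\Gamma$ is the minimal logic containing the logic $L$ and the set of formulas $\Gamma$. $\mathbf{S4D}=\mathbf{K_2}+\{B_D,4_D^-,D_\Box,T_\Box,4_\Box\}$, where $B_D$ is $p\to[\neq]\langle\neq\rangle p$; $4_D^-$ is $(p\wedge[\neq]p)\to[\neq][\neq]p$; $D_\Box$ is $[\forall]p\to\Box p$; $T_\Box$ is $\Box p\to p$; $4_\Box$ is $\Box p\to\Box\Box p$. Topological semantics: a valuation $\theta$ on a topological space $\mathfrak X$ assigns to each propositional letter a subset of $\mathfrak X$. Truth at a point is defined by: $\mathfrak X,\theta,x\models p$ iff $x\in\theta(p)$; $\bot$ is never true; $\to$ is interpreted classically; $\mathfrak X,\theta,x\models\Box\phi$ iff there is a neighborhood $U$ of $x$ with $\mathfrak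 X,\theta,y\models\phi$ for all $y\in U$; $\mathfrak X,\theta,x\models[\neq]\phi$ iff $\mathfrak X,\theta,y\models\phi$ for all $y\neq x$. A formula is valid in $\mathfrak X$ if it is true at every point under every valuation. The D-logic of a class of spaces is the set of all formulas valid in all spaces of the class. -}

module Defs where

open import Data.Bool.Base using (Bool; true; false; not; _∨_)
open import Data.Empty.Polymorphic using (⊥)
open import Data.List.Base using ([]; _∷_)
open import Data.List.Membership.Propositional renaming (_∈_ to _∈ᴸ_) using ()
open import Data.Nat.Base using (ℕ)
open import Data.Product.Base using (_×_; ∃-syntax)
open import Level using (Level; Lift; _⊔_; 0ℓ) renaming (suc to lsuc)
open import Relation.Binary.PropositionalEquality.Core using (_≡_; _≢_)
open import Relation.Unary using (Pred; _∈_; _⊆_; _≐_; _∩_; _∪_; ⋃)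
open import Relation.Unary.Polymorphic using (∅; U)

infix  20 var_
infixr 15 □_ ◇_ [≠]_ ⟨≠⟩_ [∀]_ ~_
infixr 12 _∧_
infixr 10 _⇒_
infixl 6 _⊹_

data Formula : Set where
  var_ : ℕ → Formula
  ⊥ᶠ   : Formula
  _⇒_  : Formula → Formula → Formula
  □_   : Formula → Formula
  [≠]_ : Formula → Formula

~_ : Formula → Formula
~ A = A ⇒ ⊥ᶠ

_∧_ : Formula → Formula → Formula
A ∧ B = ~ (A ⇒ ~ B)

◇_ ⟨≠⟩_ [∀]_ : Formula → Formula
◇ A   = ~ □ ~ A
⟨≠⟩ A = ~ [≠] ~ A
[∀] A = [≠] A ∧ A

subst : (ℕ → Formula) → Formula → Formula
subst σ (var p) = σ p
subst σ ⊥ᶠ      = ⊥ᶠ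
subst σ (A ⇒ B) = subst σ A ⇒ subst σ B
subst σ (□ A)   = □ subst σ A
subst σ ([≠] A) = [≠] subst σ A

-- A bimodal formula is a classical tautology when it is true under every
-- truth table in which letters and formulas beginning with a modality
-- are treated as atoms (only the values of v on these are used).

eval : (Formula → Bool) → Formula → Bool
eval v ⊥ᶠ      = false
eval v (A ⇒ B) = not (eval v A) ∨ eval v B
eval v A       = v A

Tautology : Pred Formula 0ℓ
Tautology A = ∀ v → eval v A ≡ true

p q : Formula
p = var 0
q = var 1

K□ K≠ : Formula
K□ = □ (p ⇒ q) ⇒ (□ p ⇒ □ q)
K≠ = [≠] (p ⇒ q) ⇒ ([≠] p ⇒ [≠] q)

record IsLogic {a} (L : Pred Formula a) : Set a where
  field
    taut   : Tautology ⊆ L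
    k□     : K□ ∈ L
    k≠     : K≠ ∈ L
    substL : ∀ σ {A} → A ∈ L → subst σ A ∈ L
    mp     : ∀ {A B} → (A ⇒ B) ∈ L → A ∈ L → B ∈ L
    gen□   : ∀ {A} → A ∈ L → (□ A) ∈ L
    gen≠   : ∀ {A} → A ∈ L → ([≠] A) ∈ L

-- The least logic containing Γ; see least-isLogic, least-⊇, least-minimal.

data Least {a} (Γ : Pred Formula a) : Pred Formula a where
  hyp    : ∀ {A} → A ∈ Γ → Least Γ A
  taut   : ∀ {A} → Tautology A → Least Γ A
  k□     : Least Γ K□
  k≠     : Least Γ K≠
  substL : ∀ σ {A} → Least Γ A → Least Γ (subst σ A)
  mp     : ∀ {A B} → Least Γ (A ⇒ B) → Least Γ A → Least Γ B
  gen□   : ∀ {A} → Least Γ A → Least Γ (□ A)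
  gen≠   : ∀ {A} → Least Γ A → Least Γ ([≠] A)

least-isLogic : ∀ {a} (Γ : Pred Formula a) → IsLogic (Least Γ)
least-isLogic Γ = record
  { taut = taut ; k□ = k□ ; k≠ = k≠ ; substL = substL
  ; mp = mp ; gen□ = gen□ ; gen≠ = gen≠ }

least-⊇ : ∀ {a} (Γ : Pred Formula a) → Γ ⊆ Least Γ
least-⊇ Γ = hyp

least-minimal : ∀ {a b} (Γ : Pred Formula a) (M : Pred Formula b) →
                IsLogic M → Γ ⊆ M → Least Γ ⊆ M
least-minimal Γ M isL Γ⊆M = go
  where
  module M = IsLogic isL
  go : Least Γ ⊆ M
  go (hyp h)      = Γ⊆M h
  go (taut t)     = M.taut t
  go k□           = M.k□
  go k≠           = M.k≠
  go (substL σ d) = M.substL σ (go d)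
  go (mp d e)     = M.mp (go d) (go e)
  go (gen□ d)     = M.gen□ (go d)
  go (gen≠ d)     = M.gen≠ (go d)

K₂ : Pred Formula 0ℓ
K₂ = Least ∅

_⊹_ : ∀ {a b} → Pred Formula a → Pred Formula b → Pred Formula (a ⊔ b)
L ⊹ Γ = Least (L ∪ Γ)

B-D 4-D⁻ D-□ T-□ 4-□ : Formula
B-D  = p ⇒ [≠] ⟨≠⟩ p
4-D⁻ = (p ∧ [≠] p) ⇒ [≠] [≠] p
D-□  = [∀] p ⇒ □ p
T-□  = □ p ⇒ p
4-□  = □ p ⇒ □ □ p

S4D : Pred Formula 0ℓ
S4D = K₂ ⊹ (_∈ᴸ (B-D ∷ 4-D⁻ ∷ D-□ ∷ T-□ ∷ 4-□ ∷ []))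

-- Points are compared with _≡_.  Subsets are predicates, so being open is
-- required to respect extensional equality _≐_.

record TopologicalSpace (ℓ : Level) : Set (lsuc ℓ) where
  field
    Carrier : Set ℓ
    Open    : Pred (Pred Carrier ℓ) ℓ
    open-≐  : ∀ {V W} → V ≐ W → Open V → Open W
    open-∅  : Open ∅
    open-U  : Open U
    open-∩  : ∀ {V W} → Open V → Open W → Open (V ∩ W)
    open-⋃  : (I : Set ℓ) (V : I → Pred Carrier ℓ) →
              (∀ i → Open (V i)) → Open (⋃ I V)

  Neighbourhood : Carrier → Pred (Pred Carrier ℓ) (lsuc ℓ)
  Neighbourhood x N = ∃[ V ] (Open V × x ∈ V × V ⊆ N)

open TopologicalSpace

Valuation : ∀ {ℓ} → TopologicalSpace ℓ → Set (lsuc ℓ)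
Valuation {ℓ} X = ℕ → Pred (Carrier X) ℓ

-- The quantifier over neighbourhoods puts truth one level above the space.

infix 4 _[_]_⊨_

_[_]_⊨_ : ∀ {ℓ} (X : TopologicalSpace ℓ) → Valuation X → Carrier X →
          Formula → Set (lsuc ℓ)
_[_]_⊨_ {ℓ} X θ x (var n) = Lift (lsuc ℓ) (x ∈ θ n)
X [ θ ] x ⊨ ⊥ᶠ      = ⊥
X [ θ ] x ⊨ (A ⇒ B) = X [ θ ] x ⊨ A → X [ θ ] x ⊨ B
X [ θ ] x ⊨ (□ A)   =
  ∃[ N ] (Neighbourhood X x N × (∀ y → y ∈ N → X [ θ ] y ⊨ A))
X [ θ ] x ⊨ ([≠] A) = ∀ y → y ≢ x → X [ θ ] y ⊨ A

Valid : ∀ {ℓ} → TopologicalSpace ℓ → Formula → Set (lsuc ℓ)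
Valid X A = ∀ (θ : Valuation X) x → X [ θ ] x ⊨ A

DLogic : ∀ {ℓ c} → Pred (TopologicalSpace ℓ) c → Pred Formula (lsuc ℓ ⊔ c)
DLogic C A = ∀ X → X ∈ C → Valid X A

AllSpaces : ∀ {ℓ} → Pred (TopologicalSpace ℓ) 0ℓ
AllSpaces = U

{-# OPTIONS --safe #-}
module Submission where

-- Soundness is a computation; excluded middle lowers truth sets to the universe
-- of valuations.  For completeness, a maximal consistent theory is represented by
-- a Boolean valuation of all formulas making every theorem true.  By B-D and 4-D⁻,
-- "every [∀]-formula of w is true at v" is an equivalence relation, and two points of
-- one of its classes that differ see each other along [≠].  Take the class of
-- a point refuting the nontheorem A and identify points agreeing on the subformulas
-- of A.  In this quotient [≠] fails to be inequality only at a point that sees itself;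
-- splitting every such point into two copies repairs this.  The open sets are the
-- upsets of "every boxed subformula of A true at x is true at y".

open import Defs
open import Axiom.ExcludedMiddle using (ExcludedMiddle)
open import Data.Bool.Base using (Bool; true; false; not)
open import Data.Bool.Properties using (_≟_; T-irrelevant; not-¬; ⇔→≡)
open import Data.Empty.Polymorphic using (⊥-elim)
open import Data.List.Base using (List; []; _∷_; _++_; map; foldl; cartesianProductWith)
open import Data.List.Membership.Propositional using () renaming (_∈_ to _∈ᴸ_)
open import Data.List.Membership.Propositional.Properties
  using (∈-map⁺; ∈-++⁺ˡ; ∈-++⁺ʳ; ∈-cartesianProductWith⁺)
open import Data.List.Properties using (map-cong; ∷-injectiveˡ; ∷-injectiveʳ)
open import Data.List.Relation.Unary.Any using (here; there)
open import Data.Nat.Base using (ℕ; zero; _≤_; _⊔_; _≤′_; ≤′-refl; ≤′-step)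
open import Data.Nat.Properties using (≤⇒≤′; m≤m⊔n; m≤n⊔m)
open import Data.Product.Base using (_×_; _,_; proj₁; proj₂; ∃-syntax; Σ-syntax)
open import Data.Sum.Base using (_⊎_; inj₁; inj₂)
open import Data.Unit.Base using (tt)
open import Function.Base using (_∘_; id)
open import Function.Bundles using (_⇔_; mk⇔; Equivalence)
open import Level using (Level; suc; Lift; lift; lower; 0ℓ)
open import Relation.Binary.PropositionalEquality using (_≡_; _≢_; refl; sym; trans; cong)
open import Relation.Nullary using (Dec; yes; no; ¬_; does; contradiction)
open import Relation.Nullary.Decidable using (decidable-stable; map′; True; toWitness; fromWitness)
open import Relation.Unary using (Pred; _∈_; _⊆_; _∩_)
import Relation.Unary.Polymorphic as Unary

open Equivalence using (to; from)

-- Instances of the axioms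

instance-B : ∀ A → S4D (A ⇒ [≠] ⟨≠⟩ A)
instance-B A = substL (λ _ → A) (hyp (inj₂ (here refl)))

instance-4⁻ : ∀ A → S4D ((A ∧ [≠] A) ⇒ [≠] [≠] A)
instance-4⁻ A = substL (λ _ → A) (hyp (inj₂ (there (here refl))))

instance-D : ∀ A → S4D ([∀] A ⇒ □ A)
instance-D A = substL (λ _ → A) (hyp (inj₂ (there (there (here refl)))))

instance-T : ∀ A → S4D (□ A ⇒ A)
instance-T A = substL (λ _ → A) (hyp (inj₂ (there (there (there (here refl))))))

instance-4 : ∀ A → S4D (□ A ⇒ □ □ A)
instance-4 A = substL (λ _ → A) (hyp (inj₂ (there (there (there (there (here refl)))))))

first-or-second : Formula → Formula → ℕ → Formula
first-or-second A B zero    = A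
first-or-second A B (ℕ.suc _) = B

instance-K□ : ∀ A B → S4D (□ (A ⇒ B) ⇒ (□ A ⇒ □ B))
instance-K□ A B = substL (first-or-second A B) k□

instance-K≠ : ∀ A B → S4D ([≠] (A ⇒ B) ⇒ ([≠] A ⇒ [≠] B))
instance-K≠ A B = substL (first-or-second A B) k≠

-- Boolean connectives under a valuation

eval-⇒⁺ : ∀ v {A B} → (eval v A ≡ true → eval v B ≡ true) → eval v (A ⇒ B) ≡ true
eval-⇒⁺ v {A} h with eval v A
... | true  = h refl
... | false = refl

eval-⇒⁻ : ∀ v {A B} → eval v (A ⇒ B) ≡ true → eval v A ≡ true → eval v B ≡ true
eval-⇒⁻ v {A} h a with eval v A
eval-⇒⁻ v {A} h refl | true = h

eval-~⁺ : ∀ v {A} → ¬ eval v A ≡ true → eval v (~ A) ≡ true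
eval-~⁺ v {A} h = eval-⇒⁺ v {A} {⊥ᶠ} (λ a → contradiction a h)

eval-~⁻ : ∀ v {A} → eval v (~ A) ≡ true → ¬ eval v A ≡ true
eval-~⁻ v {A} h a with () ← eval-⇒⁻ v {A} {⊥ᶠ} h a

eval-stable : ∀ v A → ¬ ¬ eval v A ≡ true → eval v A ≡ true
eval-stable v A = decidable-stable (eval v A ≟ true)

eval-∧⁺ : ∀ v {A B} → eval v A ≡ true → eval v B ≡ true → eval v (A ∧ B) ≡ true
eval-∧⁺ v {A} {B} a b =
  eval-~⁺ v {A ⇒ ~ B} λ h → eval-~⁻ v {B} (eval-⇒⁻ v {A} {~ B} h a) b

eval-∧⁻ : ∀ v {A B} → eval v (A ∧ B) ≡ true → eval v A ≡ true × eval v B ≡ true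
eval-∧⁻ v {A} {B} h with eval v A | eval v B
... | true  | true  = refl , refl

-- Enumeration of formulas

formulas : ℕ → List Formula
formulas zero    = []
formulas (ℕ.suc n) = var n ∷ ⊥ᶠ ∷ formulas n ++ map □_ (formulas n) ++ map [≠]_ (formulas n)
                     ++ cartesianProductWith _⇒_ (formulas n) (formulas n)

-- The stages are cumulative, so both sides of an implication can be brought to a common stage.
formulas-mono : ∀ {m n A} → m ≤ n → A ∈ᴸ formulas m → A ∈ᴸ formulas n
formulas-mono {A = A} m≤n = go (≤⇒≤′ m≤n)
  where
  go : ∀ {m n} → m ≤′ n → A ∈ᴸ formulas m → A ∈ᴸ formulas n
  go ≤′-refl       A∈ = A∈
  go (≤′-step m≤n) A∈ = there (there (∈-++⁺ˡ (go m≤n A∈)))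

formulas-exhaustive : ∀ A → ∃[ n ] A ∈ᴸ formulas n
formulas-exhaustive (var n) = ℕ.suc n , here refl
formulas-exhaustive ⊥ᶠ      = 1 , there (here refl)
formulas-exhaustive (A ⇒ B) with formulas-exhaustive A | formulas-exhaustive B
... | m , A∈ | n , B∈ = ℕ.suc k , there (there (∈-++⁺ʳ (formulas k)
    (∈-++⁺ʳ (map □_ (formulas k)) (∈-++⁺ʳ (map [≠]_ (formulas k))
      (∈-cartesianProductWith⁺ _⇒_ (formulas-mono (m≤m⊔n m n) A∈)
                                   (formulas-mono (m≤n⊔m m n) B∈))))))
  where k = m ⊔ n
formulas-exhaustive (□ A) with formulas-exhaustive A
... | n , A∈ = ℕ.suc n , there (there (∈-++⁺ʳ (formulas n) (∈-++⁺ˡ (∈-map⁺ □_ A∈))))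
formulas-exhaustive ([≠] A) with formulas-exhaustive A
... | n , A∈ = ℕ.suc n , there (there (∈-++⁺ʳ (formulas n)
    (∈-++⁺ʳ (map □_ (formulas n)) (∈-++⁺ˡ (∈-map⁺ [≠]_ A∈)))))

-- Theories

record IsTheory (S : Pred Formula 0ℓ) : Set where
  field
    theorems  : S4D ⊆ S
    detach    : ∀ {A B} → (A ⇒ B) ∈ S → A ∈ S → B ∈ S

  tautology : ∀ {A} → Tautology A → A ∈ S
  tautology t = theorems (taut t)

weakening : ∀ A C → Tautology (C ⇒ (A ⇒ C))
weakening A C v = eval-⇒⁺ v {C} {A ⇒ C} λ c → eval-⇒⁺ v {A} {C} λ _ → c

-- The theory generated by `S` and `A`, described through the deduction theorem instead of
-- derivations from premises.
adjoin-isTheory : ∀ {S} A → IsTheory S → IsTheory (λ C → (A ⇒ C) ∈ S)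
adjoin-isTheory {S} A S-theory = record
  { theorems = λ {C} d → detach (tautology (weakening A C)) (theorems d)
  ; detach   = λ {C} {D} h k → detach (detach (tautology (distribute C D)) h) k }
  where
  open IsTheory S-theory
  distribute : ∀ C D → Tautology ((A ⇒ (C ⇒ D)) ⇒ ((A ⇒ C) ⇒ (A ⇒ D)))
  distribute C D v with eval v A | eval v C | eval v D
  ... | false | _     | _     = refl
  ... | true  | false | _     = refl
  ... | true  | true  | false = refl
  ... | true  | true  | true  = refl

record TheoryAvoiding (B : Formula) : Set₁ where
  field
    members  : Pred Formula 0ℓ
    isTheory : IsTheory members
    avoids   : ¬ B ∈ members

  open IsTheory isTheory public

open TheoryAvoiding

-- Points and canonical relations

record Point : Set where
  field
    value : Formula → Bool
    sound : ∀ {A} → A ∈ S4D → eval value A ≡ true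

open Point

infix 4 _⊩_ _≈_ _≠→_ _□→_ _∼_

-- `eval` consults `value` only at letters and modal formulas. Hence the connectives behave
-- classically at every point and `⊥ᶠ` fails there, which makes a point consistent and complete.
_⊩_ : Point → Formula → Set
w ⊩ A = eval (value w) A ≡ true

record Sees (f : Formula → Formula) (w v : Point) : Set where
  constructor sees
  field
    see : ∀ C → w ⊩ f C → v ⊩ C

open Sees

_≈_ _≠→_ _□→_ _∼_ : Point → Point → Set
_≈_  = Sees id
_≠→_ = Sees [≠]_
_□→_ = Sees □_
_∼_  = Sees [∀]_

⊩-detach : ∀ w A B → A ⇒ B ∈ S4D → w ⊩ A → w ⊩ B
⊩-detach w A B d = eval-⇒⁻ (value w) {A} {B} (sound w d)

⊩-¬⇒~ : ∀ w A → ¬ w ⊩ A → w ⊩ ~ A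
⊩-¬⇒~ w A = eval-~⁺ (value w) {A}

⊩-~⇒¬ : ∀ w A → w ⊩ ~ A → ¬ w ⊩ A
⊩-~⇒¬ w A = eval-~⁻ (value w) {A}

⊩-stable : ∀ w A → ¬ ¬ w ⊩ A → w ⊩ A
⊩-stable w A = eval-stable (value w) A

⊩-∧⁺ : ∀ w A B → w ⊩ A → w ⊩ B → w ⊩ A ∧ B
⊩-∧⁺ w A B = eval-∧⁺ (value w) {A} {B}

[≠]-mono : ∀ w {A B} → A ⇒ B ∈ S4D → w ⊩ [≠] A → w ⊩ [≠] B
[≠]-mono w {A} {B} d = ⊩-detach w ([≠] A) ([≠] B) (mp (instance-K≠ A B) (gen≠ d))

-- Generalization gives the theorems and `K≠` gives detachment. Such a set need not be closed under
-- generalization, which is why `IsTheory` does not ask for it.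
[≠]-theory : ∀ w → IsTheory (λ C → w ⊩ [≠] C)
[≠]-theory w = record
  { theorems = λ d → sound w (gen≠ d)
  ; detach   = λ {A} {B} h → eval-⇒⁻ (value w) {[≠] A} {[≠] B}
                 (⊩-detach w ([≠] (A ⇒ B)) ([≠] A ⇒ [≠] B) (instance-K≠ A B) h) }

□-theory : ∀ w → IsTheory (λ C → w ⊩ □ C)
□-theory w = record
  { theorems = λ d → sound w (gen□ d)
  ; detach   = λ {A} {B} h → eval-⇒⁻ (value w) {□ A} {□ B}
                 (⊩-detach w (□ (A ⇒ B)) (□ A ⇒ □ B) (instance-K□ A B) h) }

[≠]-∧ : ∀ w {A B} → w ⊩ [≠] A → w ⊩ [≠] B → w ⊩ [≠] (A ∧ B)
[≠]-∧ w {A} {B} a b = T.detach (T.detach (T.tautology pair) a) b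
  where
  module T = IsTheory ([≠]-theory w)
  pair : Tautology (A ⇒ (B ⇒ A ∧ B))
  pair v with eval v A | eval v B
  ... | false | _     = refl
  ... | true  | false = refl
  ... | true  | true  = refl

-- Points are complete, so an inclusion between them is already an equality: apply it to `~ A`.
≈-reflects : ∀ {w v} → w ≈ v → ∀ A → v ⊩ A → w ⊩ A
≈-reflects {w} {v} w≈v A a = ⊩-stable w A λ n →
  ⊩-~⇒¬ v A (see w≈v (~ A) (⊩-¬⇒~ w A n)) a

infixr 11 _∨ᶠ_

_∨ᶠ_ : Formula → Formula → Formula
A ∨ᶠ B = ~ A ⇒ B

∨ᶠ-introˡ : ∀ A B → Tautology (A ⇒ A ∨ᶠ B)
∨ᶠ-introˡ A B v with eval v A
... | false = refl
... | true  = refl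

⊩-∨ᶠ-resolve : ∀ w A B → w ⊩ A ∨ᶠ B → ¬ w ⊩ A → w ⊩ B
⊩-∨ᶠ-resolve w A B h n = eval-⇒⁻ (value w) {~ A} {B} h (⊩-¬⇒~ w A n)

-- Elsewhere the first disjunct holds, here the second.
⊩-[∀]-∨ᶠ : ∀ w A B → w ⊩ [≠] A → w ⊩ B → w ⊩ [∀] (A ∨ᶠ B)
⊩-[∀]-∨ᶠ w A B h b = ⊩-∧⁺ w ([≠] (A ∨ᶠ B)) (A ∨ᶠ B)
  ([≠]-mono w (taut (∨ᶠ-introˡ A B)) h)
  (⊩-detach w B (A ∨ᶠ B) (taut (weakening (~ A) B)) b)

double-negation : ∀ A → Tautology (A ⇒ ~ ~ A)
double-negation A v with eval v A
... | false = refl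
... | true  = refl

-- If `C` failed at `w`, `B-D` would make "`~ C` elsewhere or here" a `[∀]`-truth of `w`. It would
-- then hold at `v`, against `[∀] C` there.
∼-sym : ∀ {w v} → w ∼ v → v ∼ w
∼-sym {w} {v} w∼v = sees λ C h → ⊩-stable w C λ n →
  let w⊩~C    = ⊩-¬⇒~ w C n
      [≠]C , c = eval-∧⁻ (value v) {[≠] C} {C} h
      somewhere = see w∼v (⟨≠⟩ ~ C ∨ᶠ ~ C) (⊩-[∀]-∨ᶠ w (⟨≠⟩ ~ C) (~ C)
        (⊩-detach w (~ C) ([≠] ⟨≠⟩ ~ C) (instance-B (~ C)) w⊩~C) w⊩~C)
      nowhere-else m = ⊩-~⇒¬ v ([≠] ~ ~ C) m ([≠]-mono v (taut (double-negation C)) [≠]C)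
  in ⊩-~⇒¬ v C (⊩-∨ᶠ-resolve v (⟨≠⟩ ~ C) (~ C) somewhere nowhere-else) c

-- `4-D⁻` is what yields positive introspection for `[∀]`.
∼-trans : ∀ {w v u} → w ∼ v → v ∼ u → w ∼ u
∼-trans {w} w∼v v∼u = sees λ C h → see v∼u C (see w∼v ([∀] C) (positive-introspection C h))
  where
  positive-introspection : ∀ C → w ⊩ [∀] C → w ⊩ [∀] [∀] C
  positive-introspection C h =
    let [≠]C , c = eval-∧⁻ (value w) {[≠] C} {C} h
        [≠][≠]C  = ⊩-detach w (C ∧ [≠] C) ([≠] [≠] C) (instance-4⁻ C) (⊩-∧⁺ w C ([≠] C) c [≠]C)
    in ⊩-∧⁺ w ([≠] [∀] C) ([∀] C) ([≠]-∧ w [≠][≠]C [≠]C) h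

≠→⇒∼ : ∀ {w v} → w ≠→ v → w ∼ v
≠→⇒∼ {w} w≠→v = sees λ C h → see w≠→v C (proj₁ (eval-∧⁻ (value w) {[≠] C} {C} h))

-- By `D-□`, successors along `□` stay in the class of `w`.
□→⇒∼ : ∀ {w v} → w □→ v → w ∼ v
□→⇒∼ {w} w□→v = sees λ C h → see w□→v C (⊩-detach w ([∀] C) (□ C) (instance-D C) h)

-- Subformulas and auxiliary facts

subformulas : Formula → List Formula
subformulas (var n) = var n ∷ []
subformulas ⊥ᶠ      = ⊥ᶠ ∷ []
subformulas (A ⇒ B) = (A ⇒ B) ∷ subformulas A ++ subformulas B
subformulas (□ A)   = □ A ∷ subformulas A
subformulas ([≠] A) = [≠] A ∷ subformulas A

∈-subformulas : ∀ A → A ∈ᴸ subformulas A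
∈-subformulas (var n) = here refl
∈-subformulas ⊥ᶠ      = here refl
∈-subformulas (A ⇒ B) = here refl
∈-subformulas (□ A)   = here refl
∈-subformulas ([≠] A) = here refl

map-≡⇒≗ : ∀ {a b} {A : Set a} {B : Set b} {f g : A → B} xs → map f xs ≡ map g xs →
          ∀ {x} → x ∈ᴸ xs → f x ≡ g x
map-≡⇒≗ (_ ∷ _)  eq (here refl) = ∷-injectiveˡ eq
map-≡⇒≗ (_ ∷ xs) eq (there x∈)  = map-≡⇒≗ xs (∷-injectiveʳ eq) x∈

does-⇔ : ∀ {a} {P : Set a} (P? : Dec P) → does P? ≡ true ⇔ P
does-⇔ (yes p) = mk⇔ (λ _ → p) (λ _ → refl)
does-⇔ (no n)  = mk⇔ (λ ()) (λ p → contradiction p n)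

module _ {ℓ : Level} (em : ExcludedMiddle (suc ℓ)) where

  decide : (P : Set) → Dec P
  decide P = map′ lower lift (em {Lift (suc ℓ) P})

  -- Suppose `[≠] C` holds at `w` but `C` fails at `v`. For each `F` true at `w`, the disjunction of
  -- `C` and `F` is a `[∀]`-truth of `w`; at `v` it leaves only `F`.
  ∼⇒≠→⊎≈ : ∀ {w v} → w ∼ v → w ≠→ v ⊎ w ≈ v
  ∼⇒≠→⊎≈ {w} {v} w∼v with decide (∃[ C ] (w ⊩ [≠] C × ¬ v ⊩ C))
  ... | yes (C , h , n) = inj₂ (sees λ F f → ⊩-∨ᶠ-resolve v C F (see w∼v _ (⊩-[∀]-∨ᶠ w C F h f)) n)
  ... | no  none        = inj₁ (sees λ C h → ⊩-stable v C λ n → none (C , h , n))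

  -- Lindenbaum's lemma

  -- The avoided formula `B` acts as falsum: `F ⇒ B` in `S` says that `F` is refuted, and otherwise
  -- `F` can be adjoined safely.
  extend : ∀ {B} → TheoryAvoiding B → Formula → TheoryAvoiding B
  extend {B} S F with decide ((F ⇒ B) ∈ members S)
  ... | yes _ = S
  ... | no  n = record
    { members = λ C → (F ⇒ C) ∈ members S ; isTheory = adjoin-isTheory F (isTheory S) ; avoids = n }

  extend-⊇ : ∀ {B} (S : TheoryAvoiding B) F → members S ⊆ members (extend S F)
  extend-⊇ {B} S F {C} c with decide ((F ⇒ B) ∈ members S)
  ... | yes _ = c
  ... | no  _ = detach S (tautology S (weakening F C)) c

  extend-decides : ∀ {B} (S : TheoryAvoiding B) F →
                   F ∈ members (extend S F) ⊎ (F ⇒ B) ∈ members (extend S F)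
  extend-decides {B} S F with decide ((F ⇒ B) ∈ members S)
  ... | yes h = inj₂ h
  ... | no  _ = inj₁ (tautology S λ v → eval-⇒⁺ v {F} {F} λ f → f)

  extendAll : ∀ {B} → TheoryAvoiding B → List Formula → TheoryAvoiding B
  extendAll = foldl extend

  extendAll-⊇ : ∀ {B} (S : TheoryAvoiding B) Fs → members S ⊆ members (extendAll S Fs)
  extendAll-⊇ S []       c = c
  extendAll-⊇ S (F ∷ Fs) c = extendAll-⊇ (extend S F) Fs (extend-⊇ S F c)

  extendAll-decides : ∀ {B F} (S : TheoryAvoiding B) Fs → F ∈ᴸ Fs →
                      F ∈ members (extendAll S Fs) ⊎ (F ⇒ B) ∈ members (extendAll S Fs)
  extendAll-decides S (F ∷ Fs) (there F∈) = extendAll-decides (extend S F) Fs F∈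
  extendAll-decides S (F ∷ Fs) (here refl) with extend-decides S F
  ... | inj₁ h = inj₁ (extendAll-⊇ (extend S F) Fs h)
  ... | inj₂ h = inj₂ (extendAll-⊇ (extend S F) Fs h)

  module _ {B} (S : TheoryAvoiding B) where

    stage : ℕ → TheoryAvoiding B
    stage zero      = S
    stage (ℕ.suc n) = extendAll (stage n) (formulas n)

    stage-mono : ∀ {m n} → m ≤ n → members (stage m) ⊆ members (stage n)
    stage-mono m≤n = go (≤⇒≤′ m≤n)
      where
      go : ∀ {m n} → m ≤′ n → members (stage m) ⊆ members (stage n)
      go ≤′-refl               c = c
      go (≤′-step {n = n} m≤n) c = extendAll-⊇ (stage n) (formulas n) (go m≤n c)

    Limit : Pred Formula 0ℓ
    Limit C = ∃[ n ] C ∈ members (stage n)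

    limit-isTheory : IsTheory Limit
    limit-isTheory = record
      { theorems = λ d → 0 , theorems S d
      ; detach   = λ { (m , h) (n , a) →
          m ⊔ n , detach (stage (m ⊔ n)) (stage-mono (m≤m⊔n m n) h) (stage-mono (m≤n⊔m m n) a) } }

    module L = IsTheory limit-isTheory

    limit-avoids : ¬ B ∈ Limit
    limit-avoids (n , b) = avoids (stage n) b

    limit-decides : ∀ F → F ∈ Limit ⊎ (F ⇒ B) ∈ Limit
    limit-decides F with formulas-exhaustive F
    ... | n , F∈ with extendAll-decides (stage n) (formulas n) F∈
    ...   | inj₁ h = inj₁ (ℕ.suc n , h)
    ...   | inj₂ h = inj₂ (ℕ.suc n , h)

    limit-⇒ : ∀ A C → (A ∈ Limit → C ∈ Limit) → (A ⇒ C) ∈ Limit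
    limit-⇒ A C h with limit-decides (A ⇒ C) | limit-decides A
    ... | inj₁ A⇒C   | _        = A⇒C
    ... | inj₂ _     | inj₁ a   = L.detach (L.tautology (weakening A C)) (h a)
    -- With `B` read as falsum, both `A ⇒ C` and `A` are refuted here, which a form of Peirce's law
    -- excludes.
    ... | inj₂ A⇒C⇒B | inj₂ A⇒B =
      contradiction (L.detach (L.detach (L.tautology cases) A⇒C⇒B) A⇒B) limit-avoids
      where
      cases : Tautology (((A ⇒ C) ⇒ B) ⇒ ((A ⇒ B) ⇒ B))
      cases v with eval v A | eval v B | eval v C
      ... | false | false | _     = refl
      ... | false | true  | _     = refl
      ... | true  | false | false = refl
      ... | true  | false | true  = refl
      ... | true  | true  | false = refl
      ... | true  | true  | true  = refl

    limit-value : Formula → Bool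
    limit-value C = does (decide (C ∈ Limit))

    -- Letters and modal formulas agree by the choice of `limit-value`; the connectives use that the
    -- limit decides every formula and avoids `B`.
    limit-eval-⇔ : ∀ C → eval limit-value C ≡ true ⇔ C ∈ Limit
    limit-eval-⇔ (var n) = does-⇔ (decide ((var n) ∈ Limit))
    limit-eval-⇔ (□ A)   = does-⇔ (decide ((□ A) ∈ Limit))
    limit-eval-⇔ ([≠] A) = does-⇔ (decide (([≠] A) ∈ Limit))
    limit-eval-⇔ ⊥ᶠ      = mk⇔ (λ ())
      (λ h → contradiction (L.detach (L.tautology {⊥ᶠ ⇒ B} λ _ → refl) h) limit-avoids)
    limit-eval-⇔ (A ⇒ C) = mk⇔
      (λ h → limit-⇒ A C λ a →
        to (limit-eval-⇔ C) (eval-⇒⁻ limit-value {A} {C} h (from (limit-eval-⇔ A) a)))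
      (λ h → eval-⇒⁺ limit-value {A} {C} λ a →
        from (limit-eval-⇔ C) (L.detach h (to (limit-eval-⇔ A) a)))

  lindenbaum : ∀ {S B} → IsTheory S → ¬ B ∈ S →
               ∃[ w ] (∀ C → C ∈ S → w ⊩ C) × ¬ w ⊩ B
  lindenbaum {S} {B} S-theory B∉S =
    record { value = limit-value 𝒮 ; sound = λ d → from (limit-eval-⇔ 𝒮 _) (0 , theorems 𝒮 d) } ,
    (λ C c → from (limit-eval-⇔ 𝒮 C) (0 , c)) ,
    λ b → limit-avoids 𝒮 (to (limit-eval-⇔ 𝒮 B) b)
    where
    𝒮 : TheoryAvoiding B
    𝒮 = record { members = S ; isTheory = S-theory ; avoids = B∉S }

  -- A point extending the theory of all `C` with `[≠] C` true at `w` is by definition a successor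
  -- of `w`.
  ≠→-witness : ∀ w C → ¬ w ⊩ [≠] C → ∃[ v ] w ≠→ v × ¬ v ⊩ C
  ≠→-witness w C n with lindenbaum ([≠]-theory w) n
  ... | v , w⊆v , v⊮C = v , sees w⊆v , v⊮C

  □→-witness : ∀ w C → ¬ w ⊩ □ C → ∃[ v ] w □→ v × ¬ v ⊩ C
  □→-witness w C n with lindenbaum (□-theory w) n
  ... | v , w⊆v , v⊮C = v , sees w⊆v , v⊮C

  -- The split quotient of a ∼-class

  module Quotient (w₀ : Point) (Γ : List Formula) where

    code : Point → List Bool
    code w = map (eval (value w)) Γ

    code-agree : ∀ w v {B} → B ∈ᴸ Γ → code w ≡ code v → w ⊩ B → v ⊩ B
    code-agree w v B∈ eq b = trans (sym (map-≡⇒≗ Γ eq B∈)) b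

    -- The flag true marks the second copy of a class.
    Occupied : List Bool × Bool → Set
    Occupied (u , false) = ∃[ w ] w₀ ∼ w × code w ≡ u
    Occupied (u , true)  = ∃[ w ] (w₀ ∼ w × code w ≡ u) × ∃[ v ] code v ≡ u × w ≠→ v

    -- Occupancy enters through `True`, which has at most one proof, so a copy is determined by its
    -- code and flag.
    Copy : Set
    Copy = Σ[ c ∈ List Bool × Bool ] True (decide (Occupied c))

    copy-≡ : ∀ {x y : Copy} → proj₁ x ≡ proj₁ y → x ≡ y
    copy-≡ {c , s} {_ , t} refl = cong (c ,_) (T-irrelevant s t)

    occupied : (x : Copy) → Occupied (proj₁ x)
    occupied x = toWitness (proj₂ x)

    representative : ∀ c → Occupied c → ∃[ w ] w₀ ∼ w × code w ≡ proj₁ c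
    representative (u , false) o           = o
    representative (u , true)  (w , h , _) = w , h

    -- The two copies of a class may choose different representatives; only their codes are sure to
    -- agree.
    rep : Copy → Point
    rep x = proj₁ (representative _ (occupied x))

    rep-∼ : ∀ x → w₀ ∼ rep x
    rep-∼ x = proj₁ (proj₂ (representative _ (occupied x)))

    rep-code : ∀ x → code (rep x) ≡ proj₁ (proj₁ x)
    rep-code x = proj₂ (proj₂ (representative _ (occupied x)))

    first-copy : ∀ {w} → w₀ ∼ w → Copy
    first-copy {w} w₀∼w = (code w , false) , fromWitness (w , w₀∼w , refl)

    copies-∼ : ∀ x y → rep x ∼ rep y
    copies-∼ x y = ∼-trans (∼-sym (rep-∼ x)) (rep-∼ y)

    -- Distinct copies with one code differ in the flag, so one of them is a second copy and carries
    -- the required pair of points.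
    self-seeing : ∀ (x y : Copy) → x ≢ y → proj₁ (proj₁ x) ≡ proj₁ (proj₁ y) →
                  Occupied (proj₁ (proj₁ x) , true)
    self-seeing ((u , true)  , t) y                  _   _    = toWitness t
    self-seeing ((u , false) , _) ((_ , true)  , t) _   refl = toWitness t
    self-seeing ((u , false) , _) ((_ , false) , _) x≢y refl = contradiction (copy-≡ refl) x≢y

    infix 4 _≼_

    -- The transitive (Lemmon) filtration of `□→`. Keeping `□ C` rather than `C` makes it a
    -- preorder, and `T-□` recovers `C`.
    _≼_ : Copy → Copy → Set
    x ≼ y = ∀ C → □ C ∈ᴸ Γ → rep x ⊩ □ C → rep y ⊩ □ C

    -- The Alexandrov topology of `≼`, lifted to the given universe.
    space : TopologicalSpace ℓ
    space = record
      { Carrier = Lift ℓ Copy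
      ; Open    = λ V → ∀ x y → lower x ≼ lower y → V x → V y
      ; open-≐  = λ V≐W V-open x y x≼y → proj₁ V≐W ∘ V-open x y x≼y ∘ proj₂ V≐W
      ; open-∅  = λ _ _ _ → id
      ; open-U  = λ _ _ _ → id
      ; open-∩  = λ V-open W-open x y x≼y h → V-open x y x≼y (proj₁ h) , W-open x y x≼y (proj₂ h)
      ; open-⋃  = λ I V V-open x y x≼y h → proj₁ h , V-open (proj₁ h) x y x≼y (proj₂ h) }

    θ : Valuation space
    θ n x = Lift ℓ (rep (lower x) ⊩ var n)

    -- If v lies in the class of x, that class sees itself, so x has a twin.
    distinct-copy : ∀ x {v} → rep x ≠→ v → ∃[ y ] y ≢ x × code (rep y) ≡ code v
    distinct-copy x@((u , b) , _) {v} x≠→v with decide (u ≡ code v)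
    ... | no u≢ = y , (λ y≡x → u≢ (sym (cong (proj₁ ∘ proj₁) y≡x))) , rep-code y
      where y = first-copy (∼-trans (rep-∼ x) (≠→⇒∼ x≠→v))
    ... | yes refl = y , (λ y≡x → not-¬ refl (sym (cong (proj₂ ∘ proj₁) y≡x))) , rep-code y
      where
      occupied-other : ∀ b → Occupied (code v , not b)
      occupied-other true  = v , ∼-trans (rep-∼ x) (≠→⇒∼ x≠→v) , refl
      occupied-other false = rep x , (rep-∼ x , rep-code x) , v , refl , x≠→v
      y : Copy
      y = (code v , not b) , fromWitness (occupied-other b)

    ≈⇒code-≡ : ∀ {w v} → w ≈ v → code w ≡ code v
    ≈⇒code-≡ w≈v = map-cong (λ C → ⇔→≡ (mk⇔ (see w≈v C) (≈-reflects w≈v C))) Γ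

    -- The truth lemma

    Truth : Formula → Set (suc ℓ)
    Truth B = ∀ x → space [ θ ] x ⊨ B ⇔ rep (lower x) ⊩ B

    truth-□ : ∀ {B} → □ B ∈ᴸ Γ → B ∈ᴸ Γ → Truth B → Truth (□ B)
    truth-□ {B} □B∈ B∈ truth-B (lift x) = mk⇔ forth back
      where
      forth : space [ θ ] lift x ⊨ □ B → rep x ⊩ □ B
      forth (N , (V , V-open , x∈V , V⊆N) , h) = ⊩-stable (rep x) (□ B) λ n →
        let v , x□→v , v⊮B = □→-witness (rep x) B n
            y   = first-copy (∼-trans (rep-∼ x) (□→⇒∼ x□→v))
            -- By `4-□`, each `□ C` at `rep x` gives `□ □ C`, so `□ C` passes to `v` and, being in
            -- `Γ`, to the representative of its class.
            x≼y = λ C □C∈ □C → code-agree v (rep y) □C∈ (sym (rep-code y))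
                    (see x□→v (□ C) (⊩-detach (rep x) (□ C) (□ □ C) (instance-4 C) □C))
            y∈N = V⊆N (V-open (lift x) (lift y) x≼y x∈V)
        in v⊮B (code-agree (rep y) v B∈ (rep-code y) (to (truth-B (lift y)) (h (lift y) y∈N)))
      back : rep x ⊩ □ B → space [ θ ] lift x ⊨ □ B
      -- The set where `□ B` holds is an upset because `□ B` is in `Γ`, and `T-□` gives `B` on it.
      back h = N , (N , (λ _ _ y≼z (lift k) → lift (y≼z B □B∈ k)) , lift h , id) ,
               λ y (lift k) → from (truth-B y) (⊩-detach (rep (lower y)) (□ B) B (instance-T B) k)
        where
        N : Pred (Lift ℓ Copy) ℓ
        N y = Lift ℓ (rep (lower y) ⊩ □ B)

    truth-≠ : ∀ {B} → [≠] B ∈ᴸ Γ → B ∈ᴸ Γ → Truth B → Truth ([≠] B)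
    truth-≠ {B} [≠]B∈ B∈ truth-B (lift x) = mk⇔ forth back
      where
      forth : space [ θ ] lift x ⊨ [≠] B → rep x ⊩ [≠] B
      forth h = ⊩-stable (rep x) ([≠] B) λ n →
        let v , x≠→v , v⊮B = ≠→-witness (rep x) B n
            y , y≢x , eq   = distinct-copy x x≠→v
        in v⊮B (code-agree (rep y) v B∈ eq (to (truth-B (lift y)) (h (lift y) (y≢x ∘ cong lower))))
      back : rep x ⊩ [≠] B → space [ θ ] lift x ⊨ [≠] B
      back h (lift y) y≢x = from (truth-B (lift y)) (holds (∼⇒≠→⊎≈ (copies-∼ x y)))
        where
        holds : rep x ≠→ rep y ⊎ rep x ≈ rep y → rep y ⊩ B
        holds (inj₁ x≠→y) = see x≠→y B h
        -- Here `x` and `y` are twins. Their class contains some `w ≠→ v`; move `[≠] B` from `rep x`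
        -- to `w`, pass to `B` at `v`, and move `B` to `rep y`, using equality of codes.
        holds (inj₂ x≈y)  =
          let cx≡cy = trans (sym (rep-code x)) (trans (≈⇒code-≡ x≈y) (rep-code y))
              w , (_ , cw≡cx) , v , cv≡cx , w≠→v =
                self-seeing x y (λ x≡y → y≢x (cong lift (sym x≡y))) cx≡cy
          in code-agree v (rep y) B∈ (trans cv≡cx (trans cx≡cy (sym (rep-code y))))
               (see w≠→v B (code-agree (rep x) w [≠]B∈ (trans (rep-code x) (sym cw≡cx)) h))

    truth : ∀ B → (∀ {C} → C ∈ᴸ subformulas B → C ∈ᴸ Γ) → Truth B
    truth (var n) _   x = mk⇔ (lower ∘ lower) (lift ∘ lift)
    truth ⊥ᶠ      _   x = mk⇔ (λ ()) (λ ())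
    truth (B ⇒ C) sub x = mk⇔
      (λ h → eval-⇒⁺ (value w) {B} {C} λ b → to IH-C (h (from IH-B b)))
      (λ h b → from IH-C (eval-⇒⁻ (value w) {B} {C} h (to IH-B b)))
      where
      w    = rep (lower x)
      IH-B = truth B (sub ∘ there ∘ ∈-++⁺ˡ) x
      IH-C = truth C (sub ∘ there ∘ ∈-++⁺ʳ (subformulas B)) x
    truth (□ B)   sub   = truth-□ (sub (here refl)) (sub (there (∈-subformulas B))) (truth B (sub ∘ there))
    truth ([≠] B) sub   = truth-≠ (sub (here refl)) (sub (there (∈-subformulas B))) (truth B (sub ∘ there))

  -- Completeness

  completeness : ∀ A → A ∈ DLogic (AllSpaces {ℓ}) → A ∈ S4D
  completeness A valid with decide (A ∈ S4D)
  ... | yes d = d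
  -- `rep x` may differ from `w`, but equal codes carry the truth value of `A` from one to the
  -- other.
  ... | no  n = contradiction (code-agree (rep x) w (∈-subformulas A) (rep-code x)
                  (to (truth A id (lift x)) (valid space _ θ (lift x)))) w⊮A
    where
    refuted : ∃[ w ] (∀ C → C ∈ S4D → w ⊩ C) × ¬ w ⊩ A
    refuted = lindenbaum (record { theorems = id ; detach = mp }) n
    w   = proj₁ refuted
    w⊮A = proj₂ (proj₂ refuted)
    open Quotient w (subformulas A)
    w∼w : w ∼ w
    w∼w = sees λ C h → proj₂ (eval-∧⁻ (value w) {[≠] C} {C} h)
    x : Copy
    x = first-copy w∼w

  -- Soundness

  module _ (X : TopologicalSpace ℓ) where

    -- Excluded middle turns truth at a point into a truth table, to which `Tautology` applies.
    eval-⊨ : ∀ θ x A → eval (λ B → does (em {X [ θ ] x ⊨ B})) A ≡ true ⇔ X [ θ ] x ⊨ A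
    eval-⊨ θ x (var n) = does-⇔ em
    eval-⊨ θ x (□ A)   = does-⇔ em
    eval-⊨ θ x ([≠] A) = does-⇔ em
    eval-⊨ θ x ⊥ᶠ      = mk⇔ (λ ()) (λ ())
    eval-⊨ θ x (A ⇒ B) = mk⇔
      (λ h a → to (eval-⊨ θ x B) (eval-⇒⁻ v {A} {B} h (from (eval-⊨ θ x A) a)))
      (λ h → eval-⇒⁺ v {A} {B} λ a → from (eval-⊨ θ x B) (h (to (eval-⊨ θ x A) a)))
      where v = λ B → does (em {X [ θ ] x ⊨ B})

    -- Truth sets live one universe too high to form a valuation; em lowers them.
    truth-sets : Valuation X → (ℕ → Formula) → Valuation X
    truth-sets θ σ n x = Lift ℓ (does (em {X [ θ ] x ⊨ σ n}) ≡ true)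

    ⊨-subst : ∀ θ σ A x → X [ θ ] x ⊨ subst σ A ⇔ X [ truth-sets θ σ ] x ⊨ A
    ⊨-subst θ σ (var n) x = mk⇔ (lift ∘ lift ∘ from (does-⇔ em)) (to (does-⇔ em) ∘ lower ∘ lower)
    ⊨-subst θ σ ⊥ᶠ      x = mk⇔ id id
    ⊨-subst θ σ (A ⇒ B) x = mk⇔
      (λ h → to (⊨-subst θ σ B x) ∘ h ∘ from (⊨-subst θ σ A x))
      (λ h → from (⊨-subst θ σ B x) ∘ h ∘ to (⊨-subst θ σ A x))
    ⊨-subst θ σ (□ A)   x = mk⇔
      (λ (N , nbhd , h) → N , nbhd , λ y y∈N → to (⊨-subst θ σ A y) (h y y∈N))
      (λ (N , nbhd , h) → N , nbhd , λ y y∈N → from (⊨-subst θ σ A y) (h y y∈N))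
    ⊨-subst θ σ ([≠] A) x = mk⇔
      (λ h y y≢x → to (⊨-subst θ σ A y) (h y y≢x))
      (λ h y y≢x → from (⊨-subst θ σ A y) (h y y≢x))

    open TopologicalSpace X

    whole : ∀ x → Neighbourhood x Unary.U
    whole x = Unary.U , open-U , lift tt , id

    ⊨-∧⁻ : ∀ θ x A B → X [ θ ] x ⊨ A ∧ B → X [ θ ] x ⊨ A × X [ θ ] x ⊨ B
    ⊨-∧⁻ θ x A B h =
      decidable-stable em (λ n → ⊥-elim (h λ a → contradiction a n)) ,
      decidable-stable em (λ n → ⊥-elim (h λ _ b → contradiction b n))

    valid-K□ : Valid X K□
    valid-K□ θ x (N , (V , V-open , x∈V , V⊆N) , h) (M , (W , W-open , x∈W , W⊆M) , k) =
      (V ∩ W) , (V ∩ W , open-∩ V-open W-open , (x∈V , x∈W) , id) ,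
      λ y (y∈V , y∈W) → h y (V⊆N y∈V) (k y (W⊆M y∈W))

    valid-K≠ : Valid X K≠
    valid-K≠ θ x h k y y≢x = h y y≢x (k y y≢x)

    valid-B : Valid X B-D
    valid-B θ x px y y≢x h = h x (λ x≡y → y≢x (sym x≡y)) px

    valid-4⁻ : Valid X 4-D⁻
    valid-4⁻ θ x h y y≢x z z≢y with ⊨-∧⁻ θ x p ([≠] p) h | em {Lift (suc ℓ) (z ≡ x)}
    -- The second move away may lead back to `x`; this is where the conjunct `p` is needed.
    ... | px , _  | yes (lift refl) = px
    ... | _  , p≠ | no  z≢x         = p≠ z (z≢x ∘ lift)

    valid-D : Valid X D-□
    valid-D θ x h = Unary.U , whole x , λ y _ → everywhere y
      where
      everywhere : ∀ y → X [ θ ] y ⊨ p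
      everywhere y with ⊨-∧⁻ θ x ([≠] p) p h | em {Lift (suc ℓ) (y ≡ x)}
      ... | _  , px | yes (lift refl) = px
      ... | p≠ , _  | no  y≢x         = p≠ y (y≢x ∘ lift)

    valid-T : Valid X T-□
    valid-T θ x (N , (V , _ , x∈V , V⊆N) , h) = h x (V⊆N x∈V)

    valid-4 : Valid X 4-□
    valid-4 θ x (N , (V , V-open , x∈V , V⊆N) , h) =
      -- An open set is a neighbourhood of each of its points, so `V` serves for the outer box and
      -- `N` for the inner one.
      V , (V , V-open , x∈V , id) , λ y y∈V → N , (V , V-open , y∈V , V⊆N) , h

  DLogic-isLogic : IsLogic (DLogic (AllSpaces {ℓ}))
  DLogic-isLogic = record
    { taut   = λ {A} t X _ θ x → to (eval-⊨ X θ x A) (t _)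
    ; k□     = λ X _ → valid-K□ X
    ; k≠     = λ X _ → valid-K≠ X
    ; substL = λ σ {A} valid X u θ x → from (⊨-subst X θ σ A x) (valid X u (truth-sets X θ σ) x)
    ; mp     = λ h a X u θ x → h X u θ x (a X u θ x)
    ; gen□   = λ h X u θ x → Unary.U , whole X x , λ y _ → h X u θ y
    ; gen≠   = λ h X u θ x y _ → h X u θ y }

  soundness : S4D ⊆ DLogic (AllSpaces {ℓ})
  soundness = minimal λ where
      -- `K₂` is itself a least logic, over no axioms, so minimality is applied a second time.
      (inj₁ d)                                          → minimal (λ ()) d
      (inj₂ (here refl))                                → λ X _ → valid-B X
      (inj₂ (there (here refl)))                        → λ X _ → valid-4⁻ X
      (inj₂ (there (there (here refl))))                → λ X _ → valid-D X
      (inj₂ (there (there (there (here refl)))))        → λ X _ → valid-T X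
      (inj₂ (there (there (there (there (here refl)))))) → λ X _ → valid-4 X
    where
    minimal : ∀ {Γ : Pred Formula 0ℓ} → Γ ⊆ DLogic (AllSpaces {ℓ}) → Least Γ ⊆ DLogic (AllSpaces {ℓ})
    minimal {Γ} = least-minimal Γ (DLogic (AllSpaces {ℓ})) DLogic-isLogic

theorem6p6 : (ℓ : Level) → ExcludedMiddle (suc ℓ) → (A : Formula) →
    A ∈ S4D ⇔ A ∈ DLogic (AllSpaces {ℓ})
theorem6p6 ℓ em A = mk⇔ (soundness em) (completeness em A)
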